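{- Let $G$ be a finite simple connected graph and $L$ a positive integer such that the system $$s\cdot\chi_C=1\quad\text{for every even cycle } C \text{ of } G \text{ of length}\le L$$ over $\mathbb F_2$, in the unknown $s\in\mathbb F_2^E$, is consistent. Let $W=\operatorname{span}_{\mathbb F_2}\{\chi_C\}$ be the span of these constraint cycles and let $\mathcal F$ be the family of switching classes of signings solving the system. Then the map $\pi\colon W\to\mathbb F_2$, $\pi\bigl(\sum_{C\in S}\chi_C\bigr)=|S|\bmod 2$ (for $S$ a set of constraint cycles), is a well-defined linear form, and for every even $\ell$, $$\mathbb E_{\sigma\in\mathcal F}\,\operatorname{tr}\bigl(A_\sigma^{\ell}\bigr)=\sum_{z\in W}(-1)^{\pi(z)}N_\ell(z),$$ where $\mathbb E_{\sigma\in\mathcal F}$ is the uniform average over $\mathcal F$.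
   Context: $G=(V,E)$. A signing is $\sigma\in\{\pm1\}^E$, encoded by $s\in\mathbb F_2^E$ with $\sigma_e=(-1)^{s_e}$; $A_\sigma$ is the signed adjacency matrix with $uv$ entry $\sigma_{uv}$ if $uv\in E$ and $0$ otherwise. Switching at a vertex negates the signs of all edges at it; it preserves cycle signs and the spectrum of $A_\sigma$, so $\operatorname{tr}(A_\sigma^\ell)$ depends only on the switching class of $\sigma$. $Z(G)\le\mathbb F_2^E$ is the cycle space; the switching class of $\sigma$ corresponds to the linear functional $z\mapsto s\cdot z$ on $Z(G)$. For a cycle $C$, $\chi_C\in\mathbb F_2^E$ is the indicator vector of its edge set; an even cycle is a cycle of even length. For a closed walk $w$ of length $\ell$ (with marked starting vertex and direction), its parity vector is $z(w)\in Z(G)$, with $z(w)_e$ the number of traversals of $e$ modulo $2$. $N_\ell(z)$ is the number of closed walks of length $\ell$ in $G$ with parity vector $z$. -}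

module Defs where

open import Algebra.Bundles using (CommutativeRing)
open import Algebra.Module.Bundles using (RawModule)
import Algebra.Module.Construct.TensorUnit as TensorUnit
import Algebra.Properties.Semiring.Sum as SemiringSum
open import Data.Bool.Base using (true; false; if_then_else_)
open import Data.Fin.Base as Fin using (Fin)
import Data.Fin.Properties as Fin
open import Data.Integer.Base as ℤ using (ℤ; 0ℤ; 1ℤ)
import Data.Integer.Properties as ℤ
open import Data.List.Base as List using (List; []; _∷_; _++_; allFin; cartesianProductWith)
open import Data.List.Membership.Propositional using (_∈_)
open import Data.List.Membership.Propositional.Properties
  using (∈-++⁺ˡ; ∈-++⁺ʳ; ∈-++⁻; ∈-map⁺; ∈-map⁻; ∈-allFin; ∈-cartesianProductWith⁺)
import Data.List.Membership.Setoid as SetoidMembership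
open import Data.List.Relation.Unary.All as All using (All; []; _∷_)
open import Data.List.Relation.Unary.Any as Any using (Any; here; there)
open import Data.List.Relation.Unary.Enumerates.Setoid using (IsEnumeration)
open import Data.List.Relation.Unary.Enumerates.Setoid.Properties using (deduplicate⁺)
import Data.List.Relation.Unary.Unique.Setoid as SetoidUnique
import Data.List.Relation.Unary.Unique.Propositional as ListUnique
open import Data.List.Relation.Unary.Unique.DecSetoid.Properties using (deduplicate-!)
open import Data.Nat.Base as ℕ using (ℕ; zero; suc; _≤_; NonZero; parity; s≤s)
open import Data.Nat.Divisibility using (_∣_; _∣?_)
import Data.Nat.Properties as ℕ
open import Data.Parity.Base as ℙ using (Parity; 0ℙ; 1ℙ; _⁻¹; toSign)
import Data.Parity.Properties as ℙ
open import Data.Product.Base using (∃; Σ-syntax; ∃-syntax; _×_; _,_; proj₁; proj₂)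
open import Data.Product.Properties using (≡-dec)
open import Data.Rational.Base as ℚ using (ℚ)
open import Data.Sum.Base using (_⊎_; inj₁; inj₂)
open import Data.Vec.Base as Vec using (Vec; []; _∷_; lookup; tabulate)
import Data.Vec.Properties as Vec
import Data.Vec.Relation.Unary.Any as VecAny
import Data.Vec.Relation.Unary.AllPairs as AllPairs
open import Data.Vec.Relation.Unary.Linked as Linked using (Linked)
import Data.Vec.Relation.Unary.Unique.Propositional as VecUnique
open import Function.Base using (_∘_; _on_)
open import Function.Definitions using (Injective)
open import Level using (0ℓ; _⊔_)
open import Relation.Binary.Bundles using (Setoid; DecSetoid)
import Relation.Binary.Construct.Closure.Equivalence as EqClosure
open import Relation.Binary.Construct.Closure.Equivalence using (EqClosure)
open import Relation.Binary.Construct.Closure.ReflexiveTransitive using (Star; ε; _◅_; _◅◅_)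
open import Relation.Binary.Construct.Closure.Symmetric using (fwd; bwd)
import Relation.Binary.Construct.On as On
open import Relation.Binary.PropositionalEquality
  using (_≡_; refl; sym; trans; cong; cong₂; subst; setoid; decSetoid; module ≡-Reasoning)
open import Relation.Nullary using (Dec; yes; no; does; ¬?; contradiction)
open import Relation.Nullary.Decidable using (_×-dec_; _⊎-dec_; map′)
open import Relation.Unary using (Pred; Decidable)

-- One representative of each equivalence class: a sum over the enumeration is
-- a sum over the quotient, provided the summand respects _≈_.
record Enumeration {a ℓ} (S : Setoid a ℓ) : Set (a ⊔ ℓ) where
  open Setoid S using (Carrier)
  field
    elements : List Carrier
    complete : IsEnumeration S elements
    distinct : SetoidUnique.Unique S elements

  size : ℕ
  size = List.length elements

  nonEmpty : Carrier → NonZero size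
  nonEmpty x = occupied (complete x)
    where
    occupied : ∀ {p} {P : Pred Carrier p} {xs} → Any P xs → NonZero (List.length xs)
    occupied {xs = _ ∷ _} _ = _

  sumOver : (Carrier → ℤ) → ℤ
  sumOver f = List.foldr ℤ._+_ 0ℤ (List.map f elements)

  -- The first argument only serves to exclude division by zero.
  average : Carrier → (Carrier → ℤ) → ℚ
  average x f = ℚ._/_ (sumOver f) size {{nonEmpty x}}

open Enumeration public using (sumOver; average)

vectors : ∀ {a} {A : Set a} → List A → ∀ n → List (Vec A n)
vectors xs zero    = List.[ [] ]
vectors xs (suc n) = cartesianProductWith _∷_ xs (vectors xs n)

-- Parity with its ring structure is the field 𝔽₂.
𝔽₂^ : ℕ → Set
𝔽₂^ m = Vec Parity m

infixl 6 _⊕_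
infixl 7 _·_

𝟎 : ∀ {m} → 𝔽₂^ m
𝟎 = Vec.replicate _ 0ℙ

_⊕_ : ∀ {m} → 𝔽₂^ m → 𝔽₂^ m → 𝔽₂^ m
_⊕_ = Vec.zipWith ℙ._+_

_⊛_ : ∀ {m} → Parity → 𝔽₂^ m → 𝔽₂^ m
p ⊛ x = Vec.map (p ℙ.*_) x

_·_ : ∀ {m} → 𝔽₂^ m → 𝔽₂^ m → Parity
x · y = Vec.foldr′ ℙ._+_ 0ℙ (Vec.zipWith ℙ._*_ x y)

⨁ : ∀ {m} → List (𝔽₂^ m) → 𝔽₂^ m
⨁ = List.foldr _⊕_ 𝟎

data Span {m ℓ} (X : Pred (𝔽₂^ m) ℓ) : Pred (𝔽₂^ m) ℓ where
  gen   : ∀ {x} → X x → Span X x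
  zero  : Span X 𝟎
  add   : ∀ {x y} → Span X x → Span X y → Span X (x ⊕ y)
  scale : ∀ p {x} → Span X x → Span X (p ⊛ x)

-- Elements are compared by their underlying vectors; negation is the
-- identity in characteristic two.
spanModule : ∀ {m ℓ} → Pred (𝔽₂^ m) ℓ → RawModule Parity ℓ 0ℓ
spanModule X = record
  { Carrierᴹ = ∃ (Span X)
  ; _≈ᴹ_     = _≡_ on proj₁
  ; _+ᴹ_     = λ (x , x∈) (y , y∈) → x ⊕ y , add x∈ y∈
  ; _*ₗ_     = λ p (x , x∈) → p ⊛ x , scale p x∈
  ; _*ᵣ_     = λ (x , x∈) p → p ⊛ x , scale p x∈
  ; 0ᴹ       = 𝟎 , zero
  ; -ᴹ_      = λ x → x
  }

spanSetoid : ∀ {m ℓ} → Pred (𝔽₂^ m) ℓ → Setoid ℓ 0ℓ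
spanSetoid {m} X = On.setoid {B = ∃ (Span X)} (setoid (𝔽₂^ m)) proj₁

𝔽₂-module : RawModule Parity 0ℓ 0ℓ
𝔽₂-module = TensorUnit.rawModule {R = CommutativeRing.rawRing ℙ.+-*-commutativeRing}

[-1]^ : Parity → ℤ
[-1]^ p = toSign p ℤ.◃ 1

open SemiringSum ℤ.+-*-semiring using (sum)

Matrix : ℕ → Set
Matrix n = Fin n → Fin n → ℤ

identity : ∀ {n} → Matrix n
identity i j = if does (i Fin.≟ j) then 1ℤ else 0ℤ

_⊗_ : ∀ {n} → Matrix n → Matrix n → Matrix n
(A ⊗ B) i j = sum (λ k → A i k ℤ.* B k j)

_^^_ : ∀ {n} → Matrix n → ℕ → Matrix n
A ^^ zero  = identity
A ^^ suc ℓ = A ⊗ (A ^^ ℓ)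

tr : ∀ {n} → Matrix n → ℤ
tr A = sum (λ i → A i i)

-- An edge is stored as the pair of its ends, smaller end first; hence there
-- are no loops, and injectivity excludes parallel edges.
record Graph : Set where
  field
    ∣V∣ ∣E∣        : ℕ
    ends           : Fin ∣E∣ → Fin ∣V∣ × Fin ∣V∣
    ends-ordered   : ∀ e → proj₁ (ends e) Fin.< proj₂ (ends e)
    ends-injective : Injective _≡_ _≡_ ends

module _ (G : Graph) where
  open Graph G

  V E : Set
  V = Fin ∣V∣
  E = Fin ∣E∣

  Joins : E → V → V → Set
  Joins e u v = ends e ≡ (u , v) ⊎ ends e ≡ (v , u)

  joins? : ∀ e u v → Dec (Joins e u v)
  joins? e u v = (ends e ≟² (u , v)) ⊎-dec (ends e ≟² (v , u))
    where _≟²_ = ≡-dec Fin._≟_ Fin._≟_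

  Incident : V → E → Set
  Incident v e = proj₁ (ends e) ≡ v ⊎ proj₂ (ends e) ≡ v

  incident? : ∀ v e → Dec (Incident v e)
  incident? v e = (proj₁ (ends e) Fin.≟ v) ⊎-dec (proj₂ (ends e) Fin.≟ v)

  Adj : V → V → Set
  Adj u v = ∃[ e ] Joins e u v

  adj? : ∀ u v → Dec (Adj u v)
  adj? u v = Fin.any? (λ e → joins? e u v)

  Connected : Set
  Connected = ∀ u v → Star Adj u v

  -- A walk of length ℓ is the sequence of its ℓ + 1 vertices.

  steps : ∀ {ℓ} → Vec V (suc ℓ) → Vec (V × V) ℓ
  steps (u ∷ [])    = []
  steps (u ∷ v ∷ w) = (u , v) ∷ steps (v ∷ w)

  IsClosedWalk : ∀ {ℓ} → Vec V (suc ℓ) → Set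
  IsClosedWalk w = Linked Adj w × Vec.head w ≡ Vec.last w

  isClosedWalk? : ∀ {ℓ} (w : Vec V (suc ℓ)) → Dec (IsClosedWalk w)
  isClosedWalk? w = Linked.linked? adj? w ×-dec (Vec.head w Fin.≟ Vec.last w)

  parityVector : ∀ {ℓ} → Vec V (suc ℓ) → 𝔽₂^ ∣E∣
  parityVector w = tabulate λ e → parity (Vec.count (λ (u , v) → joins? e u v) (steps w))

  N : ℕ → 𝔽₂^ ∣E∣ → ℕ
  N ℓ z = List.length (List.filter closedWithParity? (vectors (allFin ∣V∣) (suc ℓ)))
    where
    closedWithParity? : Decidable (λ w → IsClosedWalk w × parityVector w ≡ z)
    closedWithParity? w = isClosedWalk? w ×-dec Vec.≡-dec ℙ._≟_ (parityVector w) z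

  -- A cycle is traversed from some starting vertex in some direction, so
  -- each cycle of the graph has several presentations, all with the same χ.
  IsCycle : ∀ {k} → Vec V (suc k) → Set
  IsCycle {k} w = 3 ≤ k × IsClosedWalk w × VecUnique.Unique (Vec.tail w)

  record Cycle : Set where
    field
      {length} : ℕ
      walk     : Vec V (suc length)
      isCycle  : IsCycle walk

  χ : Cycle → 𝔽₂^ ∣E∣
  χ C = tabulate λ e →
    if does (VecAny.any? (λ (u , v) → joins? e u v) (steps (Cycle.walk C))) then 1ℙ else 0ℙ

  ConstraintCycle : ℕ → Set
  ConstraintCycle L = Σ[ C ∈ Cycle ] 2 ∣ Cycle.length C × Cycle.length C ≤ L

  Solves : ℕ → 𝔽₂^ ∣E∣ → Set
  Solves L s = ∀ ((C , _) : ConstraintCycle L) → s · χ C ≡ 1ℙ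

  -- The signing σₑ = (-1)^sₑ is represented by s throughout, so negating
  -- the sign of an edge flips its coordinate.

  A : 𝔽₂^ ∣E∣ → Matrix ∣V∣
  A s u v = entry (adj? u v)
    where
    entry : Dec (Adj u v) → ℤ
    entry (yes (e , _)) = [-1]^ (lookup s e)
    entry (no _)        = 0ℤ

  switch : V → 𝔽₂^ ∣E∣ → 𝔽₂^ ∣E∣
  switch v s = tabulate λ e →
    if does (incident? v e) then lookup s e ⁻¹ else lookup s e

  SwitchStep : 𝔽₂^ ∣E∣ → 𝔽₂^ ∣E∣ → Set
  SwitchStep s t = ∃[ v ] t ≡ switch v s

  switchingClasses : Setoid 0ℓ 0ℓ
  switchingClasses = EqClosure.setoid SwitchStep

  -- The family of switching classes of solutions, as a setoid of solutions.
  𝓕 : ℕ → Setoid 0ℓ 0ℓ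
  𝓕 L = On.setoid {B = ∃ (Solves L)} switchingClasses proj₁

  IsConstraintVector : ℕ → Pred (𝔽₂^ ∣E∣) 0ℓ
  IsConstraintVector L x = ∃ λ ((C , _) : ConstraintCycle L) → χ C ≡ x

  W : ℕ → RawModule Parity 0ℓ 0ℓ
  W L = spanModule (IsConstraintVector L)

  W-setoid : ℕ → Setoid 0ℓ 0ℓ
  W-setoid L = spanSetoid (IsConstraintVector L)

  -- A set of constraint cycles is a list of cycles no two of which have the
  -- same edge set.
  χs : ∀ {L} → List (ConstraintCycle L) → List (𝔽₂^ ∣E∣)
  χs = List.map (χ ∘ proj₁)

  IsSetOfCycles : ∀ {L} → List (ConstraintCycle L) → Set
  IsSetOfCycles S = ListUnique.Unique (χs S)

  IsCycleCountParity : ∀ L → (RawModule.Carrierᴹ (W L) → Parity) → Set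
  IsCycleCountParity L π = ∀ (z : RawModule.Carrierᴹ (W L)) (S : List (ConstraintCycle L)) →
    IsSetOfCycles S → proj₁ z ≡ ⨁ (χs S) → π z ≡ parity (List.length S)

-- The rest shows that 𝓕 G L and W G L have enumerations (enumerate-𝓕 and
-- enumerate-W), so quantifying over these is never vacuous.

module _ {a ℓ p} (S : DecSetoid a ℓ) {P : Pred (DecSetoid.Carrier S) p} (P? : Decidable P)
         (xs : List (DecSetoid.Carrier S)) (xs-complete : ∀ x → x ∈ xs) where
  open DecSetoid S using (Carrier) renaming (refl to ≈-refl; reflexive to ≈-reflexive)

  private
    subDecSetoid : DecSetoid _ _
    subDecSetoid = On.decSetoid {B = ∃ P} S proj₁

    T : Setoid _ _
    T = DecSetoid.setoid subDecSetoid

    open SetoidMembership T using () renaming (_∈_ to _∈ₜ_)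

    keep : List Carrier → List (∃ P)
    keep []       = []
    keep (y ∷ ys) with P? y
    ... | yes py = (y , py) ∷ keep ys
    ... | no  _  = keep ys

    keep-complete : ∀ {y} (py : P y) {ys} → y ∈ ys → (y , py) ∈ₜ keep ys
    keep-complete {y} py {z ∷ ys} y∈ with P? z | y∈
    ... | yes _  | here y≡z = here (≈-reflexive y≡z)
    ... | yes _  | there i  = there (keep-complete py i)
    ... | no ¬pz | here refl = contradiction py ¬pz
    ... | no _   | there i  = keep-complete py i

  enumerateSub : Enumeration (On.setoid {B = ∃ P} (DecSetoid.setoid S) proj₁)
  enumerateSub = record
    { elements = List.deduplicate (DecSetoid._≟_ subDecSetoid) (keep xs)
    ; complete = deduplicate⁺ subDecSetoid (λ (x , px) → keep-complete px (xs-complete x))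
    ; distinct = deduplicate-! subDecSetoid (keep xs)
    }

∈-vectors : ∀ {a} {A : Set a} {xs : List A} → (∀ x → x ∈ xs) → ∀ {n} (v : Vec A n) → v ∈ vectors xs n
∈-vectors all []      = here refl
∈-vectors all (x ∷ v) = ∈-cartesianProductWith⁺ _∷_ (all x) (∈-vectors all v)

parities : List Parity
parities = 0ℙ ∷ 1ℙ ∷ []

∈-parities : ∀ p → p ∈ parities
∈-parities 0ℙ = here refl
∈-parities 1ℙ = there (here refl)

module _ {m : ℕ} where

  ⊕-assoc : (x y z : 𝔽₂^ m) → (x ⊕ y) ⊕ z ≡ x ⊕ (y ⊕ z)
  ⊕-assoc = Vec.zipWith-assoc ℙ.+-assoc

  ⊕-comm : (x y : 𝔽₂^ m) → x ⊕ y ≡ y ⊕ x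
  ⊕-comm = Vec.zipWith-comm ℙ.+-comm

  ⊕-identityˡ : (x : 𝔽₂^ m) → 𝟎 ⊕ x ≡ x
  ⊕-identityˡ = Vec.zipWith-identityˡ ℙ.+-identityˡ

  ⊕-identityʳ : (x : 𝔽₂^ m) → x ⊕ 𝟎 ≡ x
  ⊕-identityʳ = Vec.zipWith-identityʳ ℙ.+-identityʳ

⊕-self : ∀ {m} (x : 𝔽₂^ m) → x ⊕ x ≡ 𝟎
⊕-self []      = refl
⊕-self (p ∷ x) = cong₂ _∷_ (ℙ.p+p≡0ℙ p) (⊕-self x)

⊕-selfˡ : ∀ {m} (x y : 𝔽₂^ m) → x ⊕ (x ⊕ y) ≡ y
⊕-selfˡ x y = trans (sym (⊕-assoc x x y)) (trans (cong (_⊕ y) (⊕-self x)) (⊕-identityˡ y))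

0⊛ : ∀ {m} (x : 𝔽₂^ m) → 0ℙ ⊛ x ≡ 𝟎
0⊛ []      = refl
0⊛ (_ ∷ x) = cong (0ℙ ∷_) (0⊛ x)

1⊛ : ∀ {m} (x : 𝔽₂^ m) → 1ℙ ⊛ x ≡ x
1⊛ []      = refl
1⊛ (p ∷ x) = cong (p ∷_) (1⊛ x)

subsetSums : ∀ {m} → List (𝔽₂^ m) → List (𝔽₂^ m)
subsetSums []       = List.[ 𝟎 ]
subsetSums (x ∷ xs) = subsetSums xs ++ List.map (x ⊕_) (subsetSums xs)

module _ {m ℓ} {X : Pred (𝔽₂^ m) ℓ} (xs : List (𝔽₂^ m))
         (sound : All X xs) (complete : ∀ {x} → X x → x ∈ xs) where

  private
    𝟎∈ : (ys : List (𝔽₂^ m)) → 𝟎 ∈ subsetSums ys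
    𝟎∈ []       = here refl
    𝟎∈ (_ ∷ ys) = ∈-++⁺ˡ (𝟎∈ ys)

    gen∈ : ∀ {x : 𝔽₂^ m} {ys} → x ∈ ys → x ∈ subsetSums ys
    gen∈ {x} {y ∷ ys} (here refl) = ∈-++⁺ʳ (subsetSums ys)
      (subst (_∈ List.map (x ⊕_) (subsetSums ys)) (⊕-identityʳ x) (∈-map⁺ (x ⊕_) (𝟎∈ ys)))
    gen∈ (there i) = ∈-++⁺ˡ (gen∈ i)

    ⊕∈ : ∀ {a b : 𝔽₂^ m} ys → a ∈ subsetSums ys → b ∈ subsetSums ys → a ⊕ b ∈ subsetSums ys
    ⊕∈ [] (here refl) (here refl) = here (⊕-identityʳ 𝟎)
    ⊕∈ {a} {b} (y ∷ ys) a∈ b∈ with ∈-++⁻ (subsetSums ys) a∈ | ∈-++⁻ (subsetSums ys) b∈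
    ... | inj₁ i | inj₁ j = ∈-++⁺ˡ (⊕∈ ys i j)
    ... | inj₁ i | inj₂ j with b′ , j′ , refl ← ∈-map⁻ (y ⊕_) j = ∈-++⁺ʳ (subsetSums ys)
      (subst (_∈ List.map (y ⊕_) (subsetSums ys)) eq (∈-map⁺ (y ⊕_) (⊕∈ ys i j′)))
      where
      eq : y ⊕ (a ⊕ b′) ≡ a ⊕ (y ⊕ b′)
      eq = trans (sym (⊕-assoc y a b′)) (trans (cong (_⊕ b′) (⊕-comm y a)) (⊕-assoc a y b′))
    ... | inj₂ i | inj₁ j with a′ , i′ , refl ← ∈-map⁻ (y ⊕_) i = ∈-++⁺ʳ (subsetSums ys)
      (subst (_∈ List.map (y ⊕_) (subsetSums ys)) (sym (⊕-assoc y a′ b)) (∈-map⁺ (y ⊕_) (⊕∈ ys i′ j)))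
    ... | inj₂ i | inj₂ j
      with a′ , i′ , refl ← ∈-map⁻ (y ⊕_) i
         | b′ , j′ , refl ← ∈-map⁻ (y ⊕_) j = ∈-++⁺ˡ (subst (_∈ subsetSums ys) (sym eq) (⊕∈ ys i′ j′))
      where
      open ≡-Reasoning
      eq : (y ⊕ a′) ⊕ (y ⊕ b′) ≡ a′ ⊕ b′
      eq = begin
        (y ⊕ a′) ⊕ (y ⊕ b′) ≡⟨ cong (_⊕ (y ⊕ b′)) (⊕-comm y a′) ⟩
        (a′ ⊕ y) ⊕ (y ⊕ b′) ≡⟨ ⊕-assoc a′ y (y ⊕ b′) ⟩
        a′ ⊕ (y ⊕ (y ⊕ b′)) ≡⟨ cong (a′ ⊕_) (⊕-selfˡ y b′) ⟩
        a′ ⊕ b′             ∎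

    to : ∀ {z} → Span X z → z ∈ subsetSums xs
    to (gen x)        = gen∈ (complete x)
    to zero           = 𝟎∈ xs
    to (add p q)      = ⊕∈ xs (to p) (to q)
    to (scale 0ℙ {x} p) = subst (_∈ subsetSums xs) (sym (0⊛ x)) (𝟎∈ xs)
    to (scale 1ℙ {x} p) = subst (_∈ subsetSums xs) (sym (1⊛ x)) (to p)

    from : ∀ {ys} → All X ys → ∀ {z} → z ∈ subsetSums ys → Span X z
    from []       (here refl) = zero
    from {y ∷ ys} (x ∷ xs) z∈ with ∈-++⁻ (subsetSums ys) z∈
    ... | inj₁ i = from xs i
    ... | inj₂ i with z′ , i′ , refl ← ∈-map⁻ (y ⊕_) i = add (gen x) (from xs i′)

  span? : Decidable (Span X)
  span? z = map′ (from sound) to (Any.any? (Vec.≡-dec ℙ._≟_ z) (subsetSums xs))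

module _ (G : Graph) where
  open Graph G

  private
    allWalks : ∀ k → List (Vec (V G) (suc k))
    allWalks k = vectors (allFin ∣V∣) (suc k)

    isCycle? : ∀ {k} (w : Vec (V G) (suc k)) → Dec (IsCycle G w)
    isCycle? {k} w = (3 ℕ.≤? k) ×-dec isClosedWalk? G w ×-dec
      AllPairs.allPairs? (λ u v → ¬? (u Fin.≟ v)) (Vec.tail w)

    cycleVectors : ∀ L k → List (Vec (V G) (suc k)) → List (∃ (IsConstraintVector G L))
    cycleVectors L k []       = []
    cycleVectors L k (w ∷ ws) with isCycle? w ×-dec (2 ∣? k) ×-dec (k ℕ.≤? L)
    ... | yes (c , d , b) = (_ , (record { walk = w ; isCycle = c } , d , b) , refl) ∷ cycleVectors L k ws
    ... | no _            = cycleVectors L k ws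

    cycleVectors-complete : ∀ {L} ((C , _) : ConstraintCycle G L) {ws} → Cycle.walk C ∈ ws →
                            χ G C ∈ List.map proj₁ (cycleVectors L (Cycle.length C) ws)
    cycleVectors-complete {L} K@(C , d , b) {w ∷ ws} i
      with isCycle? w ×-dec (2 ∣? Cycle.length C) ×-dec (Cycle.length C ℕ.≤? L) | i
    ... | yes _ | here refl = here refl
    ... | yes _ | there j   = there (cycleVectors-complete K j)
    ... | no ¬p | here refl = contradiction (Cycle.isCycle C , d , b) ¬p
    ... | no _  | there j   = cycleVectors-complete K j

    generatorsUpTo : ∀ L → ℕ → List (∃ (IsConstraintVector G L))
    generatorsUpTo L zero    = []
    generatorsUpTo L (suc k) = cycleVectors L k (allWalks k) ++ generatorsUpTo L k

    generators : ∀ L → List (𝔽₂^ ∣E∣)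
    generators L = List.map proj₁ (generatorsUpTo L (suc L))

    generators-sound : ∀ L → All (IsConstraintVector G L) (generators L)
    generators-sound L = go (generatorsUpTo L (suc L))
      where
      go : ∀ xs → All (IsConstraintVector G L) (List.map proj₁ xs)
      go []             = []
      go ((_ , p) ∷ xs) = p ∷ go xs

    mapProj-++ˡ : ∀ {L} {x : 𝔽₂^ ∣E∣} (as bs : List (∃ (IsConstraintVector G L))) →
                  x ∈ List.map proj₁ as → x ∈ List.map proj₁ (as ++ bs)
    mapProj-++ˡ as bs i with a , a∈ , refl ← ∈-map⁻ proj₁ i = ∈-map⁺ proj₁ (∈-++⁺ˡ a∈)

    mapProj-++ʳ : ∀ {L} {x : 𝔽₂^ ∣E∣} (as bs : List (∃ (IsConstraintVector G L))) →
                  x ∈ List.map proj₁ bs → x ∈ List.map proj₁ (as ++ bs)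
    mapProj-++ʳ as bs i with b , b∈ , refl ← ∈-map⁻ proj₁ i = ∈-map⁺ proj₁ (∈-++⁺ʳ as b∈)

    generatorsUpTo-complete : ∀ {L} ((C , _) : ConstraintCycle G L) n → Cycle.length C ℕ.< n →
                              χ G C ∈ List.map proj₁ (generatorsUpTo L n)
    generatorsUpTo-complete {L} K@(C , _) (suc n) (s≤s l≤n) with Cycle.length C ℕ.≟ n
    ... | yes refl = mapProj-++ˡ (cycleVectors L n (allWalks n)) _
                       (cycleVectors-complete K (∈-vectors ∈-allFin (Cycle.walk C)))
    ... | no l≢n   = mapProj-++ʳ (cycleVectors L n (allWalks n)) _
                       (generatorsUpTo-complete K n (ℕ.≤∧≢⇒< l≤n l≢n))

    generators-complete : ∀ L {x} → IsConstraintVector G L x → x ∈ generators L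
    generators-complete L (K@(C , _ , l≤L) , refl) = generatorsUpTo-complete K (suc L) (s≤s l≤L)

    solves? : ∀ L → Decidable (Solves G L)
    solves? L s = map′
      (λ all K → All.lookup all (generators-complete L (K , refl)))
      (λ sol → All.map (λ { (K , refl) → sol K }) (generators-sound L))
      (All.all? (λ x → (s · x) ℙ.≟ 1ℙ) (generators L))

    star : V G → 𝔽₂^ ∣E∣
    star v = tabulate λ e → if does (incident? G v e) then 1ℙ else 0ℙ

    IsStar : Pred (𝔽₂^ ∣E∣) 0ℓ
    IsStar x = ∃[ v ] star v ≡ x

    stars : List (𝔽₂^ ∣E∣)
    stars = List.map star (allFin ∣V∣)

    stars-sound : All IsStar stars
    stars-sound = go (allFin ∣V∣)
      where
      go : ∀ vs → All IsStar (List.map star vs)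
      go []       = []
      go (v ∷ vs) = (v , refl) ∷ go vs

    stars-complete : ∀ {x} → IsStar x → x ∈ stars
    stars-complete (v , refl) = ∈-map⁺ star (∈-allFin v)

    switch-⊕ : ∀ v s → switch G v s ≡ s ⊕ star v
    switch-⊕ v s = begin
      tabulate flipped                   ≡⟨ Vec.tabulate-cong pointwise ⟩
      tabulate (lookup (s ⊕ star v))     ≡⟨ Vec.tabulate∘lookup (s ⊕ star v) ⟩
      s ⊕ star v                         ∎
      where
      open ≡-Reasoning
      flipped starAt : E G → Parity
      flipped e = if does (incident? G v e) then lookup s e ⁻¹ else lookup s e
      starAt  e = if does (incident? G v e) then 1ℙ else 0ℙ

      flip≡ : ∀ e → flipped e ≡ lookup s e ℙ.+ starAt e
      flip≡ e with does (incident? G v e)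
      ... | true  = ℙ.+-comm 1ℙ (lookup s e)
      ... | false = ℙ.+-comm 0ℙ (lookup s e)

      pointwise : ∀ e → flipped e ≡ lookup (s ⊕ star v) e
      pointwise e = begin
        flipped e                             ≡⟨ flip≡ e ⟩
        lookup s e ℙ.+ starAt e               ≡⟨ cong (lookup s e ℙ.+_) (Vec.lookup∘tabulate starAt e) ⟨
        lookup s e ℙ.+ lookup (star v) e      ≡⟨ Vec.lookup-zipWith ℙ._+_ e s (star v) ⟨
        lookup (s ⊕ star v) e                 ∎

    infix 4 _∼_
    _∼_ : 𝔽₂^ ∣E∣ → 𝔽₂^ ∣E∣ → Set
    _∼_ = EqClosure (SwitchStep G)

    step-difference : ∀ {s t} (p : SwitchStep G s t) → star (proj₁ p) ≡ s ⊕ t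
    step-difference {s} (v , refl) = sym (trans (cong (s ⊕_) (switch-⊕ v s)) (⊕-selfˡ s (star v)))

    ∼⇒Span : ∀ {s t} → s ∼ t → Span IsStar (s ⊕ t)
    ∼⇒Span {s} ε = subst (Span IsStar) (sym (⊕-self s)) zero
    ∼⇒Span {s} {t} (_◅_ {j = u} st rest) = subst (Span IsStar) eq (add (first st) (∼⇒Span rest))
      where
      eq : (s ⊕ u) ⊕ (u ⊕ t) ≡ s ⊕ t
      eq = trans (⊕-assoc s u (u ⊕ t)) (cong (s ⊕_) (⊕-selfˡ u t))

      first : _ → Span IsStar (s ⊕ u)
      first (fwd p@(v , _)) = gen (v , step-difference p)
      first (bwd p@(v , _)) = gen (v , trans (step-difference p) (⊕-comm u s))

    Span⇒∼ : ∀ {z} → Span IsStar z → ∀ s → s ∼ s ⊕ z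
    Span⇒∼ (gen (v , refl)) s = fwd (v , sym (switch-⊕ v s)) ◅ ε
    Span⇒∼ zero s = subst (s ∼_) (sym (⊕-identityʳ s)) ε
    Span⇒∼ (add {x} {y} p q) s = subst (s ∼_) (⊕-assoc s x y) (Span⇒∼ p s ◅◅ Span⇒∼ q (s ⊕ x))
    Span⇒∼ (scale 0ℙ {x} p) s = subst (s ∼_) (sym (trans (cong (s ⊕_) (0⊛ x)) (⊕-identityʳ s))) ε
    Span⇒∼ (scale 1ℙ {x} p) s = subst (s ∼_) (cong (s ⊕_) (sym (1⊛ x))) (Span⇒∼ p s)

    switchingDecSetoid : DecSetoid 0ℓ 0ℓ
    switchingDecSetoid = record
      { Carrier = 𝔽₂^ ∣E∣
      ; _≈_     = _∼_
      ; isDecEquivalence = record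
        { isEquivalence = EqClosure.isEquivalence (SwitchStep G)
        ; _≟_ = λ s t → map′ (λ p → subst (s ∼_) (⊕-selfˡ s t) (Span⇒∼ p s)) ∼⇒Span
                          (span? stars stars-sound stars-complete (s ⊕ t))
        }
      }

  enumerate-𝓕 : ∀ L → Enumeration (𝓕 G L)
  enumerate-𝓕 L = enumerateSub switchingDecSetoid (solves? L) (vectors parities ∣E∣) (∈-vectors ∈-parities)

  enumerate-W : ∀ L → Enumeration (W-setoid G L)
  enumerate-W L = enumerateSub (decSetoid (Vec.≡-dec ℙ._≟_))
    (span? (generators L) (generators-sound L) (generators-complete L))
    (vectors parities ∣E∣) (∈-vectors ∈-parities)

-- Fix a solution s₀ and put π z = s₀ · z. The trace of A_σ^ℓ is the sum of (-1)^(s · z(w))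
-- over closed walks w. If z(w) ∈ W, all solutions give the value (-1)^(π (z(w))). Otherwise
-- some t vanishes on W with t · z(w) = 1; translation by t permutes the switching classes of
-- solutions and negates (-1)^(s · z(w)), so the average over the classes is zero.
module Submission where

open import Defs
open import Algebra.Module.Bundles using (RawModule)
open import Algebra.Module.Morphism.Structures using (IsModuleHomomorphism)
import Algebra.Properties.Semiring.Sum as SemiringSum
import Algebra.Solver.Ring.AlmostCommutativeRing as ACR
import Algebra.Solver.Ring.Simple as RingSolver
open import Data.Bool.Base using (true; false; if_then_else_)
open import Data.Fin.Base as Fin using (Fin)
import Data.Fin.Properties as Fin
open import Data.Integer.Base using (+_; _*_)
open import Data.Integer.Base as ℤ using (ℤ; 0ℤ; 1ℤ; -1ℤ)
import Data.Integer.Properties as ℤ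
open import Data.List.Base as List using (List; []; _∷_; _++_; allFin; cartesianProductWith)
import Data.List.Properties as List
import Data.List.Membership.Setoid as SetoidMembership
import Data.List.Membership.Setoid.Properties as ∈
import Data.List.Relation.Binary.Permutation.Setoid as SetoidPermutation
import Data.List.Relation.Binary.Permutation.Setoid.Properties as ↭
open import Data.List.Relation.Unary.All as All using (All; []; _∷_)
import Data.List.Relation.Unary.All.Properties as All
open import Data.List.Relation.Unary.AllPairs using ([]; _∷_)
open import Data.List.Relation.Unary.Any as Any using (Any; here; there)
import Data.List.Relation.Unary.Any.Properties as Any
import Data.List.Relation.Unary.Unique.Propositional as ListUnique
import Data.List.Relation.Unary.Unique.Setoid as SetoidUnique
import Data.List.Relation.Unary.Unique.Setoid.Properties as Unique
open import Data.Nat.Base as ℕ using (ℕ; suc; NonZero; parity)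
open import Data.Nat.Divisibility using (_∣_)
import Data.Nat.Properties as ℕ
open import Data.Parity.Base as ℙ using (Parity; 0ℙ; 1ℙ; _⁻¹)
import Data.Parity.Properties as ℙ
open import Data.Product.Base using (∃; Σ-syntax; ∃-syntax; _×_; _,_; proj₁; proj₂)
open import Data.Rational.Base using (_/_)
open import Data.Rational.Unnormalised.Base using (mkℚᵘ; *≡*)
import Data.Rational.Properties as ℚ
open import Data.Sum.Base using (_⊎_; inj₁; inj₂)
open import Data.Vec.Base as Vec using (Vec; []; _∷_; lookup; tabulate)
import Data.Vec.Properties as Vec
open import Data.Vec.Relation.Unary.Linked as Linked using (Linked; [-]; _∷_)
open import Function.Base using (_∘_; id)
open import Level using (Level)
open import Relation.Binary.Bundles using (Setoid)
import Relation.Binary.Construct.Closure.Equivalence as EqClosure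
open import Relation.Binary.Definitions using (DecidableEquality)
open import Relation.Binary.PropositionalEquality
  using (_≡_; _≢_; refl; sym; trans; cong; cong₂; subst; subst₂; setoid; module ≡-Reasoning)
open import Relation.Nullary using (Dec; yes; no; does; ¬_; contradiction)
open import Relation.Nullary.Decidable using (_×-dec_)
open import Relation.Unary using (Pred; Decidable)

private
  variable
    a b ℓ p q : Level
    X Y : Set a

open ≡-Reasoning
open SemiringSum ℤ.+-*-semiring using (sum)
module ℙ-Solver = RingSolver (ACR.fromCommutativeRing ℙ.+-*-commutativeRing) ℙ._≟_

-- Integer sums over lists

∑ : List X → (X → ℤ) → ℤ
∑ xs f = List.foldr ℤ._+_ 0ℤ (List.map f xs)

∑-cong : ∀ {f g : X → ℤ} (xs : List X) → (∀ x → f x ≡ g x) → ∑ xs f ≡ ∑ xs g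
∑-cong xs f≗g = cong (List.foldr ℤ._+_ 0ℤ) (List.map-cong f≗g xs)

∑-zero : (xs : List X) → ∑ xs (λ _ → 0ℤ) ≡ 0ℤ
∑-zero []       = refl
∑-zero (_ ∷ xs) = trans (ℤ.+-identityˡ _) (∑-zero xs)

∑-const : ∀ (xs : List X) c → ∑ xs (λ _ → c) ≡ + List.length xs * c
∑-const []       c = sym (ℤ.*-zeroˡ c)
∑-const (_ ∷ xs) c = trans (cong (ℤ._+_ c) (∑-const xs c)) (sym (ℤ.suc-* (+ List.length xs) c))

∑-+ : ∀ (xs : List X) (f g : X → ℤ) → ∑ xs (λ x → f x ℤ.+ g x) ≡ ∑ xs f ℤ.+ ∑ xs g
∑-+ []       f g = refl
∑-+ (x ∷ xs) f g = trans (cong (λ s → f x ℤ.+ g x ℤ.+ s) (∑-+ xs f g)) (interchange (f x) (g x) _ _)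
  where
  open import Algebra.Properties.CommutativeSemigroup ℤ.+-commutativeSemigroup using (interchange)

∑-*ˡ : ∀ c (xs : List X) (f : X → ℤ) → c * ∑ xs f ≡ ∑ xs (λ x → c * f x)
∑-*ˡ c []       f = ℤ.*-zeroʳ c
∑-*ˡ c (x ∷ xs) f = trans (ℤ.*-distribˡ-+ c (f x) _) (cong (ℤ._+_ (c * f x)) (∑-*ˡ c xs f))

∑-++ : ∀ (xs ys : List X) (f : X → ℤ) → ∑ (xs ++ ys) f ≡ ∑ xs f ℤ.+ ∑ ys f
∑-++ []       ys f = sym (ℤ.+-identityˡ _)
∑-++ (x ∷ xs) ys f = trans (cong (ℤ._+_ (f x)) (∑-++ xs ys f)) (sym (ℤ.+-assoc (f x) _ _))

∑-map : ∀ (h : X → Y) (xs : List X) (f : Y → ℤ) → ∑ (List.map h xs) f ≡ ∑ xs (f ∘ h)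
∑-map h xs f = cong (List.foldr ℤ._+_ 0ℤ) (sym (List.map-∘ xs))

∑-swap : ∀ (xs : List X) (ys : List Y) (f : X → Y → ℤ) →
         ∑ xs (λ x → ∑ ys (f x)) ≡ ∑ ys (λ y → ∑ xs (λ x → f x y))
∑-swap []       ys f = sym (∑-zero ys)
∑-swap (x ∷ xs) ys f = trans (cong (ℤ._+_ (∑ ys (f x))) (∑-swap xs ys f)) (sym (∑-+ ys (f x) _))

∑-cartesianProductWith : ∀ {Z : Set a} (h : X → Y → Z) xs ys (f : Z → ℤ) →
  ∑ (cartesianProductWith h xs ys) f ≡ ∑ xs (λ x → ∑ ys (λ y → f (h x y)))
∑-cartesianProductWith h []       ys f = refl
∑-cartesianProductWith h (x ∷ xs) ys f = trans (∑-++ (List.map (h x) ys) _ f)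
  (cong₂ ℤ._+_ (∑-map (h x) ys f) (∑-cartesianProductWith h xs ys f))

sum≡∑ : ∀ {n} (f : Fin n → ℤ) → sum f ≡ ∑ (allFin n) f
sum≡∑ f = trans (go f) (cong (List.foldr ℤ._+_ 0ℤ) (sym (List.map-tabulate id f)))
  where
  go : ∀ {n} (f : Fin n → ℤ) → sum f ≡ List.foldr ℤ._+_ 0ℤ (List.tabulate f)
  go {ℕ.zero} f = refl
  go {suc n}  f = cong (ℤ._+_ (f Fin.zero)) (go (f ∘ Fin.suc))

-- Sums over the classes of a setoid and their reindexing

module _ (S : Setoid a ℓ) where
  open Setoid S using (Carrier; _≈_) renaming (refl to ≈-refl; sym to ≈-sym; trans to ≈-trans)
  open SetoidMembership S using (_∈_)
  open SetoidUnique S using (Unique)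
  open SetoidPermutation S using (_↭_; ↭-refl; ↭-trans; ↭-sym; prep)
  open ↭ S using (≋⇒↭; shift; xs↭ys⇒|xs|≡|ys|)

  -- The head of `xs` is found in `ys`, moved to the front and removed. Distinctness of `xs` keeps
  -- its tail inside what remains, and equality of lengths leaves nothing over at the end.
  unique⇒↭ : ∀ {xs ys} → Unique xs → (∀ {x} → x ∈ xs → x ∈ ys) →
             List.length xs ≡ List.length ys → xs ↭ ys
  unique⇒↭ {[]}     {[]} _ _ _ = ↭-refl
  unique⇒↭ {x ∷ xs} {ys} (x∉xs ∷ xs!) xs⊆ys len
    with as , bs , y , x≈y , ys≋ ← ∈.∈-∃++ S (xs⊆ys (here ≈-refl)) =
    ↭-trans (prep ≈-refl (unique⇒↭ xs! xs⊆as++bs len′)) (↭-sym ys↭)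
    where
    ys↭ : ys ↭ x ∷ as ++ bs
    ys↭ = ↭-trans (≋⇒↭ ys≋) (shift (≈-sym x≈y) as bs)

    len′ : List.length xs ≡ List.length (as ++ bs)
    len′ = ℕ.suc-injective (trans len (xs↭ys⇒|xs|≡|ys| ys↭))

    xs⊆as++bs : ∀ {z} → z ∈ xs → z ∈ as ++ bs
    xs⊆as++bs {z} z∈xs with ↭.∈-resp-↭ S ys↭ (xs⊆ys (there z∈xs))
    ... | here z≈x = contradiction (∈.∈-resp-≈ S z≈x z∈xs) (All.All¬⇒¬Any x∉xs)
    ... | there z∈ = z∈

  ∑-↭ : ∀ {f : Carrier → ℤ} → (∀ {x y} → x ≈ y → f x ≡ f y) → ∀ {xs ys} → xs ↭ ys → ∑ xs f ≡ ∑ ys f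
  ∑-↭ f-cong p = ↭.foldr-commMonoid (setoid ℤ) ℤ.+-0-isCommutativeMonoid
    (↭.map⁺ S (setoid ℤ) f-cong p)

  -- An injective self-map of a finite quotient is a bijection: the images of the representatives
  -- are pairwise inequivalent, lie in enumerated classes and are as many as the classes.
  sumOver-injection : (En : Enumeration S) {f : Carrier → ℤ} (φ : Carrier → Carrier) →
    (∀ {x y} → x ≈ y → f x ≡ f y) → (∀ {x y} → φ x ≈ φ y → x ≈ y) →
    sumOver En (f ∘ φ) ≡ sumOver En f
  sumOver-injection En {f} φ f-cong φ-inj = trans (sym (∑-map φ elements f))
    (∑-↭ f-cong (unique⇒↭ (Unique.map⁺ S S φ-inj distinct) (λ {x} _ → complete x)
                          (List.length-map φ elements)))
    where open Enumeration En

-- Iverson brackets and counting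

⟦_⟧ : {P : Set p} → Dec P → ℤ
⟦ P? ⟧ = if does P? then 1ℤ else 0ℤ

⟦⟧-yes : {P : Set p} (P? : Dec P) → P → ⟦ P? ⟧ ≡ 1ℤ
⟦⟧-yes (yes _) _  = refl
⟦⟧-yes (no ¬p) p  = contradiction p ¬p

⟦⟧-no : {P : Set p} (P? : Dec P) → ¬ P → ⟦ P? ⟧ ≡ 0ℤ
⟦⟧-no (yes p) ¬p = contradiction p ¬p
⟦⟧-no (no _)  _  = refl

⟦⟧-× : {P : Set p} {Q : Set q} (P? : Dec P) (Q? : Dec Q) → ⟦ P? ×-dec Q? ⟧ ≡ ⟦ P? ⟧ * ⟦ Q? ⟧
⟦⟧-× (yes _) Q? = sym (ℤ.*-identityˡ ⟦ Q? ⟧)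
⟦⟧-× (no _)  Q? = refl

length-filter≡∑ : {P : Pred X p} (P? : Decidable P) (xs : List X) →
                  + List.length (List.filter P? xs) ≡ ∑ xs (λ x → ⟦ P? x ⟧)
length-filter≡∑ P? []       = refl
length-filter≡∑ P? (x ∷ xs) with P? x
... | yes _ = trans (ℤ.pos-+ 1 _) (cong (ℤ._+_ 1ℤ) (length-filter≡∑ P? xs))
... | no  _ = trans (length-filter≡∑ P? xs) (sym (ℤ.+-identityˡ _))

-- The list is read through `g` because an element of a span carries a derivation besides its
-- vector, and only the vectors are compared. Exactly one entry lies over `z`.
∑-indicator : (g : Y → X) (_≟_ : DecidableEquality X) (f : X → ℤ) (z : X) {ys : List Y} →
  ListUnique.Unique (List.map g ys) → Any (λ y → z ≡ g y) ys →
  ∑ ys (λ y → f (g y) * ⟦ z ≟ g y ⟧) ≡ f z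
∑-indicator g _≟_ f z {y ∷ ys} (y∉ ∷ _) (here refl) = begin
  f z * ⟦ z ≟ z ⟧ ℤ.+ ∑ ys (λ y′ → f (g y′) * ⟦ z ≟ g y′ ⟧)
    ≡⟨ cong₂ ℤ._+_ (trans (cong (f z *_) (⟦⟧-yes (z ≟ z) refl)) (ℤ.*-identityʳ (f z))) (rest y∉) ⟩
  f z ℤ.+ 0ℤ
    ≡⟨ ℤ.+-identityʳ (f z) ⟩
  f z ∎
  where
  rest : ∀ {ys} → All (z ≢_) (List.map g ys) → ∑ ys (λ y → f (g y) * ⟦ z ≟ g y ⟧) ≡ 0ℤ
  rest {[]}     []         = refl
  rest {y ∷ ys} (z≢ ∷ z≢s) = cong₂ ℤ._+_
    (trans (cong (f (g y) *_) (⟦⟧-no (z ≟ g y) z≢)) (ℤ.*-zeroʳ (f (g y)))) (rest z≢s)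
∑-indicator g _≟_ f z {y ∷ ys} (y∉ ∷ ys!) (there z∈) = trans
  (cong₂ ℤ._+_
    (trans (cong (f (g y) *_) (⟦⟧-no (z ≟ g y) z≢y)) (ℤ.*-zeroʳ (f (g y))))
    (∑-indicator g _≟_ f z ys! z∈))
  (ℤ.+-identityˡ (f z))
  where
  z≢y : z ≢ g y
  z≢y refl = All.All¬⇒¬Any y∉ (Any.map⁺ z∈)

-- Cancellation in ℤ and ℚ

i≡-i⇒i≡0 : ∀ {i} → i ≡ ℤ.- i → i ≡ 0ℤ
i≡-i⇒i≡0 {+ ℕ.zero} _ = refl

/-cancel : ∀ n .{{_ : NonZero n}} i → (+ n * i) / n ≡ i / 1
-- The fractions are compared unnormalised, by cross-multiplication; `mkℚᵘ` stores the denominator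
-- minus one, hence `n` and `0`.
/-cancel (suc n) i = ℚ.fromℚᵘ-cong {mkℚᵘ (+ suc n * i) n} {mkℚᵘ i 0}
  (*≡* (trans (ℤ.*-identityʳ _) (ℤ.*-comm (+ suc n) i)))

-- Signs and the bilinear form on 𝔽₂^m

[-1]^-+ : ∀ p q → [-1]^ (p ℙ.+ q) ≡ [-1]^ p * [-1]^ q
[-1]^-+ 0ℙ 0ℙ = refl
[-1]^-+ 0ℙ 1ℙ = refl
[-1]^-+ 1ℙ 0ℙ = refl
[-1]^-+ 1ℙ 1ℙ = refl

·-distribˡ : ∀ {m} (s x y : 𝔽₂^ m) → s · (x ⊕ y) ≡ (s · x) ℙ.+ (s · y)
·-distribˡ []      []      []      = refl
·-distribˡ (p ∷ s) (q ∷ x) (r ∷ y) = trans (cong (p ℙ.* (q ℙ.+ r) ℙ.+_) (·-distribˡ s x y))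
  (ℙ-Solver.solve 5 (λ p q r u v → p :* (q :+ r) :+ (u :+ v) := (p :* q :+ u) :+ (p :* r :+ v))
    refl p q r (s · x) (s · y))
  where open ℙ-Solver

·-comm : ∀ {m} (x y : 𝔽₂^ m) → x · y ≡ y · x
·-comm []      []      = refl
·-comm (p ∷ x) (q ∷ y) = cong₂ ℙ._+_ (ℙ.*-comm p q) (·-comm x y)

·-distribʳ : ∀ {m} (s x y : 𝔽₂^ m) → (x ⊕ y) · s ≡ (x · s) ℙ.+ (y · s)
·-distribʳ s x y = trans (·-comm (x ⊕ y) s)
  (trans (·-distribˡ s x y) (cong₂ ℙ._+_ (·-comm s x) (·-comm s y)))

·-zeroˡ : ∀ {m} (x : 𝔽₂^ m) → 𝟎 · x ≡ 0ℙ
·-zeroˡ []      = refl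
·-zeroˡ (_ ∷ x) = ·-zeroˡ x

·-zeroʳ : ∀ {m} (s : 𝔽₂^ m) → s · 𝟎 ≡ 0ℙ
·-zeroʳ s = trans (·-comm s 𝟎) (·-zeroˡ s)

·-⊛ : ∀ {m} p (s x : 𝔽₂^ m) → s · (p ⊛ x) ≡ p ℙ.* (s · x)
·-⊛ 0ℙ s x = trans (cong (s ·_) (0⊛ x)) (·-zeroʳ s)
·-⊛ 1ℙ s x = cong (s ·_) (1⊛ x)

·-tabulate-0 : ∀ {m} (s : 𝔽₂^ m) → s · tabulate (λ _ → 0ℙ) ≡ 0ℙ
·-tabulate-0 []      = refl
·-tabulate-0 (p ∷ s) = cong₂ ℙ._+_ (ℙ.*-zeroʳ p) (·-tabulate-0 s)

-- For prepending a step to a walk, which changes the parity vector in one coordinate. Both vectors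
-- are tabulations because `parityVector` is one.
·-tabulate-flip : ∀ {m} (s : 𝔽₂^ m) {f g : Fin m → Parity} e →
  f e ≡ g e ⁻¹ → (∀ e′ → e′ ≢ e → f e′ ≡ g e′) →
  (s · tabulate f) ≡ lookup s e ℙ.+ (s · tabulate g)
·-tabulate-flip (p ∷ s) {f} {g} Fin.zero flip same = begin
  (p ℙ.* f Fin.zero) ℙ.+ (s · tabulate (f ∘ Fin.suc))
    ≡⟨ cong₂ (λ x y → p ℙ.* x ℙ.+ (s · y)) flip (Vec.tabulate-cong (λ i → same (Fin.suc i) λ ())) ⟩
  p ℙ.* (1ℙ ℙ.+ g Fin.zero) ℙ.+ (s · tabulate (g ∘ Fin.suc))
    ≡⟨ solve 3 (λ p q u → p :* (con 1ℙ :+ q) :+ u := p :+ (p :* q :+ u)) refl p (g Fin.zero) _ ⟩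
  p ℙ.+ ((p ℙ.* g Fin.zero) ℙ.+ (s · tabulate (g ∘ Fin.suc))) ∎
  where open ℙ-Solver
·-tabulate-flip (p ∷ s) {f} {g} (Fin.suc e) flip same = begin
  (p ℙ.* f Fin.zero) ℙ.+ (s · tabulate (f ∘ Fin.suc))
    ≡⟨ cong₂ (λ x y → p ℙ.* x ℙ.+ y) (same Fin.zero λ ())
         (·-tabulate-flip s e flip (λ i i≢e → same (Fin.suc i) (i≢e ∘ Fin.suc-injective))) ⟩
  (p ℙ.* g Fin.zero) ℙ.+ (lookup s e ℙ.+ (s · tabulate (g ∘ Fin.suc)))
    ≡⟨ solve 3 (λ u v w → u :+ (v :+ w) := v :+ (u :+ w)) refl (p ℙ.* g Fin.zero) (lookup s e) _ ⟩
  lookup s e ℙ.+ ((p ℙ.* g Fin.zero) ℙ.+ (s · tabulate (g ∘ Fin.suc))) ∎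
  where open ℙ-Solver

·-Span-cong : ∀ {m} {P : Pred (𝔽₂^ m) ℓ} (s t : 𝔽₂^ m) → (∀ {x} → P x → s · x ≡ t · x) →
              ∀ {z} → Span P z → s · z ≡ t · z
·-Span-cong s t eq (gen p)         = eq p
·-Span-cong s t eq zero            = trans (·-zeroʳ s) (sym (·-zeroʳ t))
·-Span-cong s t eq (add {x} {y} u v) = begin
  s · (x ⊕ y)       ≡⟨ ·-distribˡ s x y ⟩
  (s · x) ℙ.+ (s · y)   ≡⟨ cong₂ ℙ._+_ (·-Span-cong s t eq u) (·-Span-cong s t eq v) ⟩
  (t · x) ℙ.+ (t · y)   ≡⟨ ·-distribˡ t x y ⟨
  t · (x ⊕ y)       ∎
·-Span-cong s t eq (scale p {x} u) = begin
  s · (p ⊛ x)       ≡⟨ ·-⊛ p s x ⟩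
  p ℙ.* (s · x)     ≡⟨ cong (p ℙ.*_) (·-Span-cong s t eq u) ⟩
  p ℙ.* (t · x)     ≡⟨ ·-⊛ p t x ⟨
  t · (p ⊛ x)       ∎

-- Separating a vector from a subspace

nondegenerate : ∀ {m} (z : 𝔽₂^ m) → z ≡ 𝟎 ⊎ (∃[ t ] t · z ≡ 1ℙ)
nondegenerate []       = inj₁ refl
-- The witness is the unit vector at the first nonzero coordinate.
nondegenerate (1ℙ ∷ z) = inj₂ (1ℙ ∷ 𝟎 , cong (1ℙ ℙ.+_) (·-zeroˡ z))
nondegenerate (0ℙ ∷ z) with nondegenerate z
... | inj₁ refl     = inj₁ refl
... | inj₂ (t , tz) = inj₂ (0ℙ ∷ t , tz)

Separates : ∀ {m} → List (𝔽₂^ m) → 𝔽₂^ m → Set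
Separates xs z = ∃[ t ] All (λ x → t · x ≡ 0ℙ) xs × t · z ≡ 1ℙ

-- The double annihilator of a finitely generated space is the space itself. If t kills
-- xs but not x, then z is corrected by x, or t by a functional separating z ⊕ x.
span-or-separate : ∀ {m} {P : Pred (𝔽₂^ m) ℓ} {xs} → All (Span P) xs → ∀ z →
                   Span P z ⊎ Separates xs z
span-or-separate [] z with nondegenerate z
... | inj₁ refl     = inj₁ zero
... | inj₂ (t , tz) = inj₂ (t , [] , tz)
span-or-separate {P = P} {x ∷ xs} (px ∷ pxs) z with span-or-separate pxs z
... | inj₁ pz = inj₁ pz
... | inj₂ (t , txs , tz) with t · x in tx
...   | 0ℙ = inj₂ (t , tx ∷ txs , tz)
...   | 1ℙ with span-or-separate pxs (x ⊕ z)
...     | inj₁ pxz = inj₁ (subst (Span P) (⊕-selfˡ x z) (add px pxz))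
...     | inj₂ (u , uxs , uxz) with u · x in ux | trans (sym (·-distribˡ u x z)) uxz
...       | 0ℙ | uz = inj₂ (u , ux ∷ uxs , uz)
...       | 1ℙ | uz = inj₂ (t ⊕ u , trans (·-distribʳ x t u) (cong₂ ℙ._+_ tx ux)
              ∷ All.zipWith (λ {y} (ty , uy) → trans (·-distribʳ y t u) (cong₂ ℙ._+_ ty uy)) (txs , uxs)
              , trans (·-distribʳ z t u) (trans (cong (ℙ._+ (u · z)) tz) uz))

-- Elements of a span as sums of sets of generators

module _ {m} (g : X → 𝔽₂^ m) where

  private
    ⨁g : List X → 𝔽₂^ m
    ⨁g = ⨁ ∘ List.map g

    Unique-g : List X → Set
    Unique-g = ListUnique.Unique ∘ List.map g

  -- Adding a generator to a set of generators modulo 2: a repetition cancels.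
  toggle : X → List X → List X
  toggle k [] = List.[ k ]
  toggle k (j ∷ S) with Vec.≡-dec ℙ._≟_ (g k) (g j)
  ... | yes _ = S
  ... | no  _ = j ∷ toggle k S

  ⨁-toggle : ∀ k S → ⨁g (toggle k S) ≡ g k ⊕ ⨁g S
  ⨁-toggle k [] = refl
  ⨁-toggle k (j ∷ S) with Vec.≡-dec ℙ._≟_ (g k) (g j)
  ... | yes gk≡gj = trans (sym (⊕-selfˡ (g j) (⨁g S))) (cong (_⊕ (g j ⊕ ⨁g S)) (sym gk≡gj))
  ... | no _ = begin
    g j ⊕ ⨁g (toggle k S)   ≡⟨ cong (g j ⊕_) (⨁-toggle k S) ⟩
    g j ⊕ (g k ⊕ ⨁g S)      ≡⟨ ⊕-assoc (g j) (g k) _ ⟨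
    (g j ⊕ g k) ⊕ ⨁g S      ≡⟨ cong (_⊕ ⨁g S) (⊕-comm (g j) (g k)) ⟩
    (g k ⊕ g j) ⊕ ⨁g S      ≡⟨ ⊕-assoc (g k) (g j) _ ⟩
    g k ⊕ (g j ⊕ ⨁g S)      ∎

  -- Used with the predicate of differing from `g j`, to carry distinctness past an entry `j` that
  -- `toggle` keeps.
  All-toggle : {P : Pred (𝔽₂^ m) p} → ∀ {k S} → P (g k) → All P (List.map g S) →
               All P (List.map g (toggle k S))
  All-toggle {S = []} pk [] = pk ∷ []
  All-toggle {k = k} {j ∷ S} pk (pj ∷ ps) with Vec.≡-dec ℙ._≟_ (g k) (g j)
  ... | yes _ = ps
  ... | no  _ = pj ∷ All-toggle pk ps

  Unique-toggle : ∀ k {S} → Unique-g S → Unique-g (toggle k S)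
  Unique-toggle k {[]} [] = [] ∷ []
  Unique-toggle k {j ∷ S} (j∉S ∷ S!) with Vec.≡-dec ℙ._≟_ (g k) (g j)
  ... | yes _     = S!
  ... | no  gk≢gj = All-toggle (gk≢gj ∘ sym) j∉S ∷ Unique-toggle k S!

  -- On lists with distinct `g`-values this is the symmetric difference, elements being identified
  -- by those values.
  merge : List X → List X → List X
  merge S T = List.foldr toggle T S

  ⨁-merge : ∀ S T → ⨁g (merge S T) ≡ ⨁g S ⊕ ⨁g T
  ⨁-merge []      T = sym (⊕-identityˡ _)
  ⨁-merge (k ∷ S) T = trans (⨁-toggle k (merge S T))
    (trans (cong (g k ⊕_) (⨁-merge S T)) (sym (⊕-assoc (g k) _ _)))

  Unique-merge : ∀ S {T} → Unique-g T → Unique-g (merge S T)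
  Unique-merge []      T! = T!
  Unique-merge (k ∷ S) T! = Unique-toggle k (Unique-merge S T!)

  -- Addition in the span corresponds to symmetric difference, and the scalars are only 0 and 1.
  -- Hence a condition on sums of sets of cycles reaches every element of `W`.
  Span⇒⨁ : ∀ {z} → Span (λ x → ∃ λ k → g k ≡ x) z → ∃[ S ] Unique-g S × z ≡ ⨁g S
  Span⇒⨁ (gen (k , refl)) = List.[ k ] , [] ∷ [] , sym (⊕-identityʳ (g k))
  Span⇒⨁ zero = [] , [] , refl
  Span⇒⨁ (add p q) with S , S! , refl ← Span⇒⨁ p | T , T! , refl ← Span⇒⨁ q =
    merge S T , Unique-merge S T! , sym (⨁-merge S T)
  Span⇒⨁ (scale 0ℙ {x} p) = [] , [] , 0⊛ x
  Span⇒⨁ (scale 1ℙ {x} p) with S , S! , eq ← Span⇒⨁ p = S , S! , trans (1⊛ x) eq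

-- Matrix powers as sums over vertex sequences

walkWeight : ∀ {n k} → Matrix n → Vec (Fin n) (suc k) → ℤ
walkWeight M (u ∷ [])    = 1ℤ
walkWeight M (u ∷ v ∷ w) = M u v * walkWeight M (v ∷ w)

-- Expanding the leftmost factor of the power chooses the second vertex, just as `vectors` chooses
-- its first entry. The sum runs over all vertex sequences from `i`; the factor `identity` pins the
-- last vertex to `j`.
^^-walks : ∀ {n} (M : Matrix n) k i j → (M ^^ k) i j ≡
  ∑ (vectors (allFin n) k) (λ w → walkWeight M (i ∷ w) * identity (Vec.last (i ∷ w)) j)
^^-walks M ℕ.zero i j = sym (trans (ℤ.+-identityʳ _) (ℤ.*-identityˡ (identity i j)))
^^-walks {n} M (suc k) i j = begin
  sum (λ v → M i v * (M ^^ k) v j)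
    ≡⟨ sum≡∑ (λ v → M i v * (M ^^ k) v j) ⟩
  ∑ (allFin n) (λ v → M i v * (M ^^ k) v j)
    ≡⟨ ∑-cong (allFin n) (λ v → trans (cong (M i v *_) (^^-walks M k v j)) (∑-*ˡ (M i v) (vectors (allFin n) k) _)) ⟩
  ∑ (allFin n) (λ v → ∑ (vectors (allFin n) k) (λ w →
    M i v * (walkWeight M (v ∷ w) * identity (Vec.last (v ∷ w)) j)))
    ≡⟨ ∑-cong (allFin n) (λ v → ∑-cong (vectors (allFin n) k) (λ w → ℤ.*-assoc (M i v) (walkWeight M (v ∷ w)) _)) ⟨
  ∑ (allFin n) (λ v → ∑ (vectors (allFin n) k) (λ w →
    walkWeight M (i ∷ v ∷ w) * identity (Vec.last (i ∷ v ∷ w)) j))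
    ≡⟨ ∑-cartesianProductWith _∷_ (allFin n) (vectors (allFin n) k) _ ⟨
  ∑ (vectors (allFin n) (suc k)) (λ w → walkWeight M (i ∷ w) * identity (Vec.last (i ∷ w)) j) ∎

tr-^^-walks : ∀ {n} (M : Matrix n) k → tr (M ^^ k) ≡
  ∑ (vectors (allFin n) (suc k)) (λ w → walkWeight M w * identity (Vec.last w) (Vec.head w))
tr-^^-walks {n} M k = begin
  tr (M ^^ k)
    ≡⟨ sum≡∑ (λ i → (M ^^ k) i i) ⟩
  ∑ (allFin n) (λ i → (M ^^ k) i i)
    ≡⟨ ∑-cong (allFin n) (λ i → ^^-walks M k i i) ⟩
  ∑ (allFin n) (λ i → ∑ (vectors (allFin n) k) (λ w → walkWeight M (i ∷ w) * identity (Vec.last (i ∷ w)) i))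
    ≡⟨ ∑-cartesianProductWith _∷_ (allFin n) (vectors (allFin n) k) _ ⟨
  ∑ (vectors (allFin n) (suc k)) (λ w → walkWeight M w * identity (Vec.last w) (Vec.head w)) ∎

-- Signed walks and traces of powers of the signed adjacency matrix

module _ (G : Graph) where
  open Graph G

  -- Edges are stored with the smaller end first, so two edges joining the same pair have the same
  -- orientation, and injectivity of `ends` identifies them.
  joins-unique : ∀ {e e′ u v} → Joins G e u v → Joins G e′ u v → e′ ≡ e
  joins-unique (inj₁ p) (inj₁ q) = ends-injective (trans q (sym p))
  joins-unique (inj₂ p) (inj₂ q) = ends-injective (trans q (sym p))
  joins-unique {e} {e′} (inj₁ p) (inj₂ q) = contradiction (ordered q) (Fin.<-asym (ordered p))
    where
    ordered : ∀ {e u v} → ends e ≡ (u , v) → u Fin.< v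
    ordered {e} refl = ends-ordered e
  joins-unique (inj₂ p) (inj₁ q) = joins-unique (inj₁ p) (inj₂ q)

  -- The new step traverses `e` and, by `joins-unique`, no other edge, so only the coordinate at `e`
  -- flips.
  ·-parityVector-∷ : ∀ s {e u v k} (w : Vec (V G) k) → Joins G e u v →
    s · parityVector G (u ∷ v ∷ w) ≡ lookup s e ℙ.+ (s · parityVector G (v ∷ w))
  ·-parityVector-∷ s {e} {u} {v} w e-uv = ·-tabulate-flip s e (flip (joins? G e u v)) (λ e′ → same e′ (joins? G e′ u v))
    where
    count : E G → ℕ
    count e′ = Vec.count (λ (u , v) → joins? G e′ u v) (steps G (v ∷ w))

    -- The decision is an argument here and in `same`, so that matching on it reduces the
    -- conditional produced by `Vec.count`.
    flip : (e? : Dec (Joins G e u v)) → parity ((if does e? then suc else id) (count e)) ≡ parity (count e) ⁻¹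
    flip (yes _) = ℙ.+-homo-+ 1 (count e)
    flip (no ¬p) = contradiction e-uv ¬p

    same : ∀ e′ (e′? : Dec (Joins G e′ u v)) → e′ ≢ e →
           parity ((if does e′? then suc else id) (count e′)) ≡ parity (count e′)
    same e′ (yes p) e′≢e = contradiction (joins-unique e-uv p) e′≢e
    same e′ (no _)  _    = refl

  -- Each step contributes the sign of its edge. The product depends on the numbers of traversals
  -- only modulo 2, because signs square to 1.
  walkWeight-A : ∀ s {k} (w : Vec (V G) (suc k)) → Linked (Adj G) w →
                 walkWeight (A G s) w ≡ [-1]^ (s · parityVector G w)
  walkWeight-A s (u ∷ []) _ = cong [-1]^ (sym (·-tabulate-0 s))
  walkWeight-A s (u ∷ v ∷ w) (adj ∷ link) with adj? G u v
  ... | no ¬adj       = contradiction adj ¬adj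
  ... | yes (e , e-uv) = begin
    [-1]^ (lookup s e) * walkWeight (A G s) (v ∷ w)
      ≡⟨ cong ([-1]^ (lookup s e) *_) (walkWeight-A s (v ∷ w) link) ⟩
    [-1]^ (lookup s e) * [-1]^ (s · parityVector G (v ∷ w))
      ≡⟨ [-1]^-+ (lookup s e) _ ⟨
    [-1]^ (lookup s e ℙ.+ (s · parityVector G (v ∷ w)))
      ≡⟨ cong [-1]^ (·-parityVector-∷ s w e-uv) ⟨
    [-1]^ (s · parityVector G (u ∷ v ∷ w)) ∎

  walkWeight-unlinked : ∀ s {k} (w : Vec (V G) (suc k)) → ¬ Linked (Adj G) w → walkWeight (A G s) w ≡ 0ℤ
  walkWeight-unlinked s (u ∷ []) ¬link = contradiction [-] ¬link
  walkWeight-unlinked s (u ∷ v ∷ w) ¬link with adj? G u v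
  ... | no _    = refl
  ... | yes adj@(e , _) = trans
    (cong ([-1]^ (lookup s e) *_) (walkWeight-unlinked s (v ∷ w) (¬link ∘ (adj ∷_))))
    (ℤ.*-zeroʳ ([-1]^ (lookup s e)))

  -- A sequence that is not a closed walk either has different ends, where `identity` vanishes, or
  -- has a non-adjacent step, where the weight vanishes.
  closedWalkWeight : ∀ s {k} (w : Vec (V G) (suc k)) →
    walkWeight (A G s) w * identity (Vec.last w) (Vec.head w) ≡
      ⟦ isClosedWalk? G w ⟧ * [-1]^ (s · parityVector G w)
  closedWalkWeight s w = by-cases (isClosedWalk? G w)
    where
    weight : ℤ
    weight = walkWeight (A G s) w * identity (Vec.last w) (Vec.head w)

    by-cases : (c? : Dec (IsClosedWalk G w)) → weight ≡ ⟦ c? ⟧ * [-1]^ (s · parityVector G w)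
    by-cases (yes (link , closed)) = begin
      weight
        ≡⟨ cong₂ _*_ (walkWeight-A s w link) (⟦⟧-yes (Vec.last w Fin.≟ Vec.head w) (sym closed)) ⟩
      [-1]^ (s · parityVector G w) * 1ℤ
        ≡⟨ ℤ.*-comm ([-1]^ (s · parityVector G w)) 1ℤ ⟩
      1ℤ * [-1]^ (s · parityVector G w) ∎
    by-cases (no ¬closed) with Vec.last w Fin.≟ Vec.head w
    ... | no _     = ℤ.*-zeroʳ (walkWeight (A G s) w)
    ... | yes last = trans (ℤ.*-identityʳ (walkWeight (A G s) w))
      (walkWeight-unlinked s w (λ link → ¬closed (link , sym last)))

  tr-A^^ : ∀ s k → tr (A G s ^^ k) ≡ ∑ (vectors (allFin ∣V∣) (suc k)) (λ w →
    ⟦ isClosedWalk? G w ⟧ * [-1]^ (s · parityVector G w))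
  tr-A^^ s k = trans (tr-^^-walks (A G s) k) (∑-cong (vectors (allFin ∣V∣) (suc k)) (closedWalkWeight s))

  N≡∑ : ∀ k z → + N G k z ≡ ∑ (vectors (allFin ∣V∣) (suc k)) (λ w →
    ⟦ isClosedWalk? G w ⟧ * ⟦ Vec.≡-dec ℙ._≟_ (parityVector G w) z ⟧)
  N≡∑ k z = trans (length-filter≡∑ _ (vectors (allFin ∣V∣) (suc k)))
    (∑-cong (vectors (allFin ∣V∣) (suc k)) (λ w → ⟦⟧-× (isClosedWalk? G w) (Vec.≡-dec ℙ._≟_ (parityVector G w) z)))

  -- Switching and translation of signings

  mark : V G → V G → Parity
  mark v u = if does (u Fin.≟ v) then 1ℙ else 0ℙ

  -- Switching at `v` adds the coboundary of the indicator `mark v`: an edge flips when exactly one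
  -- of its ends is `v`, and both cannot be, as there are no loops.
  lookup-switch : ∀ v s {e a b} → Joins G e a b →
    lookup (switch G v s) e ≡ mark v a ℙ.+ mark v b ℙ.+ lookup s e
  lookup-switch v s {e} e-ab = trans (Vec.lookup∘tabulate _ e) (by-orientation e-ab)
    where
    flipped : Parity
    flipped = if does (incident? G v e) then lookup s e ⁻¹ else lookup s e

    by-ends : ∀ {a b} → ends e ≡ (a , b) → flipped ≡ mark v a ℙ.+ mark v b ℙ.+ lookup s e
    by-ends refl with proj₁ (ends e) Fin.≟ v | proj₂ (ends e) Fin.≟ v
    ... | yes p | yes q = contradiction (trans p (sym q)) (Fin.<⇒≢ (ends-ordered e))
    ... | yes _ | no _  = refl
    ... | no _  | yes _ = refl
    ... | no _  | no _  = refl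

    by-orientation : ∀ {a b} → Joins G e a b → flipped ≡ mark v a ℙ.+ mark v b ℙ.+ lookup s e
    by-orientation (inj₁ eq) = by-ends eq
    by-orientation {a} {b} (inj₂ eq) =
      trans (by-ends eq) (cong (ℙ._+ lookup s e) (ℙ.+-comm (mark v b) (mark v a)))

  -- The marks telescope along the walk, so that only its two ends contribute.
  switch-·-parityVector : ∀ v s {k} (w : Vec (V G) (suc k)) → Linked (Adj G) w →
    switch G v s · parityVector G w ≡
      mark v (Vec.head w) ℙ.+ mark v (Vec.last w) ℙ.+ (s · parityVector G w)
  switch-·-parityVector v s (a ∷ []) _ = begin
    switch G v s · parityVector G (a ∷ [])                  ≡⟨ ·-tabulate-0 (switch G v s) ⟩
    0ℙ                                                      ≡⟨ cong₂ ℙ._+_ (ℙ.p+p≡0ℙ (mark v a)) (·-tabulate-0 s) ⟨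
    mark v a ℙ.+ mark v a ℙ.+ (s · parityVector G (a ∷ [])) ∎
  switch-·-parityVector v s (a ∷ b ∷ w) ((e , e-ab) ∷ link) = begin
    switch G v s · parityVector G (a ∷ b ∷ w)
      ≡⟨ ·-parityVector-∷ (switch G v s) w e-ab ⟩
    lookup (switch G v s) e ℙ.+ (switch G v s · parityVector G (b ∷ w))
      ≡⟨ cong₂ ℙ._+_ (lookup-switch v s e-ab) (switch-·-parityVector v s (b ∷ w) link) ⟩
    (mark v a ℙ.+ mark v b ℙ.+ lookup s e) ℙ.+
      (mark v b ℙ.+ mark v (Vec.last (b ∷ w)) ℙ.+ (s · parityVector G (b ∷ w)))
      -- The mark of `b`, end of one step and start of the next, cancels because the solver has
      -- coefficients in 𝔽₂.
      ≡⟨ solve 5 (λ a b c x y → (a :+ b :+ x) :+ (b :+ c :+ y) := a :+ c :+ (x :+ y)) refl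
           (mark v a) (mark v b) (mark v (Vec.last (b ∷ w))) (lookup s e) _ ⟩
    mark v a ℙ.+ mark v (Vec.last (b ∷ w)) ℙ.+ (lookup s e ℙ.+ (s · parityVector G (b ∷ w)))
      ≡⟨ cong (mark v a ℙ.+ mark v (Vec.last (b ∷ w)) ℙ.+_) (·-parityVector-∷ s w e-ab) ⟨
    mark v a ℙ.+ mark v (Vec.last (b ∷ w)) ℙ.+ (s · parityVector G (a ∷ b ∷ w)) ∎
    where open ℙ-Solver

  -- On a closed walk the marks of the two ends coincide and cancel, so a single switching changes
  -- nothing; equality then extends over the equivalence closure.
  switching-invariant : ∀ {k} (w : Vec (V G) (suc k)) → IsClosedWalk G w → ∀ {s t} →
    Setoid._≈_ (switchingClasses G) s t → s · parityVector G w ≡ t · parityVector G w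
  switching-invariant w (link , closed) =
    EqClosure.gfold (Setoid.isEquivalence (setoid Parity)) (_· parityVector G w)
      (λ { {s} (v , refl) → sym (begin
        switch G v s · parityVector G w
          ≡⟨ switch-·-parityVector v s w link ⟩
        mark v (Vec.head w) ℙ.+ mark v (Vec.last w) ℙ.+ (s · parityVector G w)
          ≡⟨ cong (λ u → mark v (Vec.head w) ℙ.+ mark v u ℙ.+ (s · parityVector G w)) closed ⟨
        mark v (Vec.head w) ℙ.+ mark v (Vec.head w) ℙ.+ (s · parityVector G w)
          ≡⟨ cong (ℙ._+ (s · parityVector G w)) (ℙ.p+p≡0ℙ (mark v (Vec.head w))) ⟩
        s · parityVector G w ∎) })

  -- Switching is itself translation by a fixed vector, and translations commute. Through this,
  -- translation by `t` acts on switching classes.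
  switch-⊕ : ∀ v s t → switch G v (s ⊕ t) ≡ switch G v s ⊕ t
  switch-⊕ v s t = trans (Vec.tabulate-cong pointwise) (Vec.tabulate∘lookup (switch G v s ⊕ t))
    where
    flip : (p : Parity) → E G → Parity
    flip p e = if does (incident? G v e) then p ⁻¹ else p

    flip-+ : ∀ p q e → flip (p ℙ.+ q) e ≡ flip p e ℙ.+ q
    flip-+ p q e with does (incident? G v e)
    ... | true  = sym (ℙ.+-assoc 1ℙ p q)
    ... | false = refl

    pointwise : ∀ e → flip (lookup (s ⊕ t) e) e ≡ lookup (switch G v s ⊕ t) e
    pointwise e = begin
      flip (lookup (s ⊕ t) e) e               ≡⟨ cong (λ p → flip p e) (Vec.lookup-zipWith ℙ._+_ e s t) ⟩
      flip (lookup s e ℙ.+ lookup t e) e      ≡⟨ flip-+ (lookup s e) (lookup t e) e ⟩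
      flip (lookup s e) e ℙ.+ lookup t e      ≡⟨ cong (ℙ._+ lookup t e) (Vec.lookup∘tabulate _ e) ⟨
      lookup (switch G v s) e ℙ.+ lookup t e  ≡⟨ Vec.lookup-zipWith ℙ._+_ e (switch G v s) t ⟨
      lookup (switch G v s ⊕ t) e             ∎

  ⊕-cong-switching : ∀ t {s s′} → Setoid._≈_ (switchingClasses G) s s′ →
                     Setoid._≈_ (switchingClasses G) (s ⊕ t) (s′ ⊕ t)
  ⊕-cong-switching t = EqClosure.gmap (_⊕ t) λ { {s} (v , refl) → v , sym (switch-⊕ v s t) }

  -- Translation by `t` is an involution, so applying it again undoes it. This is its injectivity on
  -- classes.
  ⊕-cancel-switching : ∀ t {s s′} → Setoid._≈_ (switchingClasses G) (s ⊕ t) (s′ ⊕ t) →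
                       Setoid._≈_ (switchingClasses G) s s′
  ⊕-cancel-switching t {s} {s′} p = subst₂ (Setoid._≈_ (switchingClasses G)) (cancel s) (cancel s′)
    (⊕-cong-switching t p)
    where
    cancel : ∀ s → (s ⊕ t) ⊕ t ≡ s
    cancel s = trans (⊕-assoc s t t) (trans (cong (s ⊕_) (⊕-self t)) (⊕-identityʳ s))

  -- The linear form π given by a solution

  module _ (L : ℕ) (s₀ : 𝔽₂^ ∣E∣) (s₀-solves : Solves G L s₀) where

    private
      WSpan : Pred (𝔽₂^ ∣E∣) _
      WSpan = Span (IsConstraintVector G L)

    π : RawModule.Carrierᴹ (W G L) → Parity
    π (z , _) = s₀ · z

    -- The solution `s₀` takes the value 1 on each constraint cycle, so by linearity it counts
    -- cycles modulo 2. The count therefore depends only on the sum of the cycles.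
    π-counts : IsCycleCountParity G L π
    π-counts z S _ refl = go S
      where
      go : ∀ S → s₀ · ⨁ (χs G S) ≡ parity (List.length S)
      go []      = ·-zeroʳ s₀
      go (K ∷ S) = begin
        s₀ · (χ G (proj₁ K) ⊕ ⨁ (χs G S))           ≡⟨ ·-distribˡ s₀ (χ G (proj₁ K)) (⨁ (χs G S)) ⟩
        (s₀ · χ G (proj₁ K)) ℙ.+ (s₀ · ⨁ (χs G S))  ≡⟨ cong₂ ℙ._+_ (s₀-solves K) (go S) ⟩
        1ℙ ℙ.+ parity (List.length S)               ≡⟨ ℙ.+-homo-+ 1 (List.length S) ⟨
        parity (suc (List.length S))                ∎

    -- By `Span⇒⨁` every element of `W` is the sum of some set of constraint cycles, which fixes the
    -- value there.
    π-unique : ∀ π′ → IsCycleCountParity G L π′ → ∀ z → π′ z ≡ π z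
    π-unique π′ counts z with S , S! , z≡ ← Span⇒⨁ (χ G ∘ proj₁) (proj₂ z) =
      trans (counts z S S! z≡) (sym (π-counts z S S! z≡))

    π-linear : IsModuleHomomorphism (W G L) 𝔽₂-module π
    π-linear = record
      { isBimoduleHomomorphism = record
        { +ᴹ-isGroupHomomorphism = record
          { isMonoidHomomorphism = record
            { isMagmaHomomorphism = record
              { isRelHomomorphism = record { cong = cong (s₀ ·_) }
              ; homo = λ (x , _) (y , _) → ·-distribˡ s₀ x y
              }
            ; ε-homo = ·-zeroʳ s₀
            }
          ; ⁻¹-homo = λ _ → refl
          }
        ; *ₗ-homo = λ p (x , _) → ·-⊛ p s₀ x
        ; *ᵣ-homo = λ p (x , _) → trans (·-⊛ p s₀ x) (ℙ.*-comm p (s₀ · x))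
        }
      }

    solutions-agree : ∀ {s} → Solves G L s → ∀ {z} → WSpan z → s · z ≡ s₀ · z
    solutions-agree {s} s-solves = ·-Span-cong s s₀ λ { (K , refl) → trans (s-solves K) (sym (s₀-solves K)) }

    -- Character sums over the family and the sum of the traces

    module _ (classes : Enumeration (𝓕 G L)) (elementsOfW : Enumeration (W-setoid G L)) where
      open Enumeration classes using (size)
      open Enumeration elementsOfW using (elements; complete; distinct)

      private
        _≟_ : DecidableEquality (𝔽₂^ ∣E∣)
        _≟_ = Vec.≡-dec ℙ._≟_

      -- `W` is finite, so the list of all its elements serves as the spanning list for
      -- `span-or-separate`.
      spanning : All WSpan (List.map proj₁ elements)
      spanning = All.map⁺ (All.universal proj₂ elements)

      annihilates : ∀ {t} → All (λ x → t · x ≡ 0ℙ) (List.map proj₁ elements) → ∀ {z} → WSpan z → t · z ≡ 0ℙ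
      annihilates t⊥ {z} z∈W = All.lookup t⊥ (Any.map⁺ (complete (z , z∈W)))

      -- Orthogonality of characters: reindexing by the translation shows that the sum equals its
      -- own negative. The hypothesis `invariant` makes the summand a function on classes.
      sum-character-outside-W : ∀ {z} → (∀ {s s′} → Setoid._≈_ (switchingClasses G) s s′ → s · z ≡ s′ · z) →
        Separates (List.map proj₁ elements) z → sumOver classes (λ (s , _) → [-1]^ (s · z)) ≡ 0ℤ
      sum-character-outside-W {z} invariant (t , t⊥ , tz) = i≡-i⇒i≡0 (begin
        sumOver classes (λ (s , _) → [-1]^ (s · z))
          ≡⟨ sumOver-injection (𝓕 G L) classes translate (cong [-1]^ ∘ invariant) (⊕-cancel-switching t) ⟨
        sumOver classes (λ (s , _) → [-1]^ ((s ⊕ t) · z))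
          ≡⟨ ∑-cong (Enumeration.elements classes) negates ⟩
        sumOver classes (λ (s , _) → -1ℤ * [-1]^ (s · z))
          ≡⟨ ∑-*ˡ -1ℤ (Enumeration.elements classes) _ ⟨
        -1ℤ * sumOver classes (λ (s , _) → [-1]^ (s · z))
          ≡⟨ ℤ.-1*i≡-i _ ⟩
        ℤ.- sumOver classes (λ (s , _) → [-1]^ (s · z)) ∎)
        where
        translate : ∃ (Solves G L) → ∃ (Solves G L)
        -- Since `t` vanishes on the constraint vectors, the value 1 on each constraint cycle is
        -- kept.
        translate (s , s-solves) = s ⊕ t , λ K → trans (·-distribʳ (χ G (proj₁ K)) s t)
          (cong₂ ℙ._+_ (s-solves K) (annihilates {t} t⊥ (gen (K , refl))))

        negates : ∀ (σ : ∃ (Solves G L)) → [-1]^ ((proj₁ σ ⊕ t) · z) ≡ -1ℤ * [-1]^ (proj₁ σ · z)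
        negates (s , _) = begin
          [-1]^ ((s ⊕ t) · z)         ≡⟨ cong [-1]^ (·-distribʳ z s t) ⟩
          [-1]^ ((s · z) ℙ.+ (t · z)) ≡⟨ cong (λ p → [-1]^ ((s · z) ℙ.+ p)) tz ⟩
          [-1]^ ((s · z) ℙ.+ 1ℙ)      ≡⟨ [-1]^-+ (s · z) 1ℙ ⟩
          [-1]^ (s · z) * -1ℤ         ≡⟨ ℤ.*-comm ([-1]^ (s · z)) -1ℤ ⟩
          -1ℤ * [-1]^ (s · z)         ∎

      -- The bracket covers both alternatives in one formula: it selects the single representative
      -- of `z` if `z` lies in `W` and makes the sum over `W` zero otherwise. This form allows the
      -- sums over walks and over `W` to be exchanged.
      sum-character : ∀ {z} → (∀ {s s′} → Setoid._≈_ (switchingClasses G) s s′ → s · z ≡ s′ · z) →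
        sumOver classes (λ (s , _) → [-1]^ (s · z)) ≡
          + size * sumOver elementsOfW (λ x → [-1]^ (π x) * ⟦ z ≟ proj₁ x ⟧)
      sum-character {z} invariant with span-or-separate spanning z
      ... | inj₁ z∈W = begin
        sumOver classes (λ (s , _) → [-1]^ (s · z))
          ≡⟨ ∑-cong (Enumeration.elements classes) (λ (s , s-solves) → cong [-1]^ (solutions-agree {s} s-solves z∈W)) ⟩
        sumOver classes (λ _ → [-1]^ (s₀ · z))
          ≡⟨ ∑-const (Enumeration.elements classes) ([-1]^ (s₀ · z)) ⟩
        + size * [-1]^ (s₀ · z)
          ≡⟨ cong (+ size *_) (∑-indicator proj₁ _≟_ (λ x → [-1]^ (s₀ · x)) z
               (Unique.map⁺ (W-setoid G L) (setoid _) id distinct) (complete (z , z∈W))) ⟨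
        + size * sumOver elementsOfW (λ x → [-1]^ (π x) * ⟦ z ≟ proj₁ x ⟧) ∎
      ... | inj₂ sep@(t , t⊥ , tz) = begin
        sumOver classes (λ (s , _) → [-1]^ (s · z))
          ≡⟨ sum-character-outside-W invariant sep ⟩
        0ℤ
          ≡⟨ ℤ.*-zeroʳ (+ size) ⟨
        + size * 0ℤ
          ≡⟨ cong (+ size *_) (∑-zero elements) ⟨
        + size * sumOver elementsOfW (λ _ → 0ℤ)
          ≡⟨ cong (+ size *_) (∑-cong elements outside) ⟨
        + size * sumOver elementsOfW (λ x → [-1]^ (π x) * ⟦ z ≟ proj₁ x ⟧) ∎
        where
        outside : ∀ (x : ∃ WSpan) → [-1]^ (π x) * ⟦ z ≟ proj₁ x ⟧ ≡ 0ℤ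
        outside (x , x∈W) = trans (cong ([-1]^ (s₀ · x) *_) (⟦⟧-no (z ≟ x) z≢x)) (ℤ.*-zeroʳ ([-1]^ (s₀ · x)))
          where
          z≢x : z ≢ x
          z≢x refl = contradiction (trans (sym tz) (annihilates {t} t⊥ x∈W)) λ ()

      -- The averaged identity multiplied by the number of classes, which keeps the computation in
      -- ℤ.
      sum-traces : ∀ k → sumOver classes (λ (s , _) → tr (A G s ^^ k)) ≡
        + size * sumOver elementsOfW (λ z → [-1]^ (π z) * + N G k (proj₁ z))
      sum-traces k = begin
        sumOver classes (λ (s , _) → tr (A G s ^^ k))
          ≡⟨ ∑-cong (Enumeration.elements classes) (λ (s , _) → tr-A^^ s k) ⟩
        ∑ (Enumeration.elements classes) (λ (s , _) → ∑ walks (λ w → closed w * [-1]^ (s · parityVector G w)))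
          ≡⟨ ∑-swap (Enumeration.elements classes) walks _ ⟩
        ∑ walks (λ w → sumOver classes (λ (s , _) → closed w * [-1]^ (s · parityVector G w)))
          ≡⟨ ∑-cong walks (λ w → ∑-*ˡ (closed w) (Enumeration.elements classes) _) ⟨
        ∑ walks (λ w → closed w * sumOver classes (λ (s , _) → [-1]^ (s · parityVector G w)))
          ≡⟨ ∑-cong walks per-walk ⟩
        ∑ walks (λ w → + size * sumOver elementsOfW (λ z → [-1]^ (π z) * (closed w * hits w z)))
          ≡⟨ ∑-*ˡ (+ size) walks _ ⟨
        + size * ∑ walks (λ w → sumOver elementsOfW (λ z → [-1]^ (π z) * (closed w * hits w z)))
          ≡⟨ cong (+ size *_) (∑-swap walks elements _) ⟩
        + size * sumOver elementsOfW (λ z → ∑ walks (λ w → [-1]^ (π z) * (closed w * hits w z)))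
          ≡⟨ cong (+ size *_) (∑-cong elements (λ z → ∑-*ˡ ([-1]^ (π z)) walks _)) ⟨
        + size * sumOver elementsOfW (λ z → [-1]^ (π z) * ∑ walks (λ w → closed w * hits w z))
          ≡⟨ cong (+ size *_) (∑-cong elements (λ z → cong ([-1]^ (π z) *_) (N≡∑ k (proj₁ z)))) ⟨
        + size * sumOver elementsOfW (λ z → [-1]^ (π z) * + N G k (proj₁ z)) ∎
        where
        walks : List (Vec (V G) (suc k))
        walks = vectors (allFin ∣V∣) (suc k)

        closed : Vec (V G) (suc k) → ℤ
        closed w = ⟦ isClosedWalk? G w ⟧

        hits : Vec (V G) (suc k) → ∃ WSpan → ℤ
        hits w z = ⟦ parityVector G w ≟ proj₁ z ⟧

        per-walk : ∀ w → closed w * sumOver classes (λ (s , _) → [-1]^ (s · parityVector G w)) ≡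
          + size * sumOver elementsOfW (λ z → [-1]^ (π z) * (closed w * hits w z))
        per-walk w = begin
          closed w * sumOver classes (λ (s , _) → [-1]^ (s · parityVector G w))
            ≡⟨ on-closed (isClosedWalk? G w) ⟩
          closed w * (+ size * sumOver elementsOfW (λ z → [-1]^ (π z) * hits w z))
            ≡⟨ x∙yz≈y∙xz (closed w) (+ size) _ ⟩
          + size * (closed w * sumOver elementsOfW (λ z → [-1]^ (π z) * hits w z))
            ≡⟨ cong (+ size *_) (∑-*ˡ (closed w) elements _) ⟩
          + size * sumOver elementsOfW (λ z → closed w * ([-1]^ (π z) * hits w z))
            ≡⟨ cong (+ size *_) (∑-cong elements (λ z → x∙yz≈y∙xz (closed w) ([-1]^ (π z)) (hits w z))) ⟩
          + size * sumOver elementsOfW (λ z → [-1]^ (π z) * (closed w * hits w z)) ∎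
          where
          open import Algebra.Properties.CommutativeSemigroup ℤ.*-commutativeSemigroup using (x∙yz≈y∙xz)

          -- Switching invariance is available for closed walks; on other sequences the bracket
          -- makes both sides zero.
          on-closed : (c? : Dec (IsClosedWalk G w)) →
            ⟦ c? ⟧ * sumOver classes (λ (s , _) → [-1]^ (s · parityVector G w)) ≡
              ⟦ c? ⟧ * (+ size * sumOver elementsOfW (λ z → [-1]^ (π z) * hits w z))
          on-closed (yes c) = cong (1ℤ *_) (sum-character (switching-invariant w c))
          on-closed (no _)  = refl

proposition7 :
  (G : Graph) → Connected G →
  (L : ℕ) → .{{_ : NonZero L}} →
  (consistent : ∃ (Solves G L)) →
  Σ[ π ∈ (RawModule.Carrierᴹ (W G L) → Parity) ]
    IsCycleCountParity G L π ×
    (∀ π′ → IsCycleCountParity G L π′ → ∀ z → π′ z ≡ π z) ×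
    IsModuleHomomorphism (W G L) 𝔽₂-module π ×
    (∀ (classes : Enumeration (𝓕 G L)) (elementsOfW : Enumeration (W-setoid G L)) (ℓ : ℕ) → 2 ∣ ℓ →
      average classes consistent (λ (s , _) → tr (A G s ^^ ℓ))
        ≡ sumOver elementsOfW (λ z → [-1]^ (π z) * + N G ℓ (proj₁ z)) / 1)
proposition7 G _ L (s₀ , s₀-solves) =
  π G L s₀ s₀-solves , π-counts G L s₀ s₀-solves , π-unique G L s₀ s₀-solves , π-linear G L s₀ s₀-solves ,
  λ classes elementsOfW ℓ _ →
    -- The number of classes is nonzero because the class of `s₀` is among them; dividing by it
    -- turns the sum into the average.
    let instance
          size≢0 : NonZero (Enumeration.size classes)
          size≢0 = Enumeration.nonEmpty classes (s₀ , s₀-solves)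
    in trans (ℚ./-cong (sum-traces G L s₀ s₀-solves classes elementsOfW ℓ) refl)
             (/-cancel (Enumeration.size classes) _)
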